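{- For every integer $n\ge 2$, let $\mathcal{A}_n$ denote the set of Dyck $n$-paths whose terminal descent has even length and all of whose other descents to ground level (if any) have odd length. Then $|\mathcal{A}_n| = C_{n-1}$, where $C_m=\frac{1}{m+1}\binom{2m}{m}$ is the $m$-th Catalan number.
   Context: A Dyck $n$-path is a lattice path consisting of $n$ upsteps $U=(1,1)$ and $n$ downsteps $D=(1,-1)$ that starts and ends at height $0$ (ground level) and never goes below ground level. A descent is a maximal run of consecutive downsteps; its length is the number of downsteps in it. The terminal descent is the descent that ends at the final point of the path. A return is a downstep ending at ground level, and a descent to ground level is a descent whose last step is a return. -}

module Defs where

open import Data.Integer.Base using (ℤ; 0ℤ; 1ℤ; -1ℤ) renaming (_+_ to _+ℤ_; _≤_ to _≤ℤ_)
open import Data.List.Base using (List; []; _∷_; _++_; replicate; head; last; length; filter)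
open import Data.Maybe.Base using (just)
open import Data.Nat.Base using (ℕ; zero; suc; _+_; _*_; NonZero; s≤s; z≤n)
open import Data.Nat.Combinatorics using (_C_; nCk+nC[k+1]≡[n+1]C[k+1]; k>n⇒nCk≡0; nC1≡n)
open import Data.Nat.DivMod using (_/_; m*[n/m]≡n)
open import Data.Nat.Divisibility using (_∣_; _∤_; m∣m*n; ∣m+n∣m⇒∣n)
open import Data.Nat.Properties using (*-distribˡ-+; *-identityʳ; *-identityˡ; *-zeroʳ)
open import Data.Nat.Tactic.RingSolver using (solve-∀)
open import Data.Product.Base using (_×_; Σ-syntax)
open import Data.Refinement.Base using (Refinement-syntax)
open import Relation.Binary.Definitions using (DecidableEquality)
open import Relation.Binary.PropositionalEquality
  using (_≡_; _≢_; refl; cong; cong₂; subst; module ≡-Reasoning)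
open import Relation.Nullary.Decidable using (yes; no)
open import Relation.Nullary.Negation using (¬_)

data Step : Set where
  U D : Step

_≟_ : DecidableEquality Step
U ≟ U = yes refl
U ≟ D = no λ ()
D ≟ U = no λ ()
D ≟ D = yes refl

Path : Set
Path = List Step

count : Step → Path → ℕ
count s p = length (filter (s ≟_) p)

rise : Step → ℤ
rise U = 1ℤ
rise D = -1ℤ

-- The height of the final point of a path that starts at ground level;
-- the heights of the points of p are those of its prefixes.
height : Path → ℤ
height []      = 0ℤ
height (s ∷ p) = rise s +ℤ height p

record IsDyck (n : ℕ) (p : Path) : Set where
  field
    upsteps     : count U p ≡ n
    downsteps   : count D p ≡ n
    ends        : height p ≡ 0ℤ
    nonnegative : ∀ q r → q ++ r ≡ p → 0ℤ ≤ℤ height q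

record Descent (p : Path) : Set where
  field
    before       : Path
    len          : ℕ
    after        : Path
    split        : before ++ replicate len D ++ after ≡ p
    nonempty     : NonZero len
    maximalLeft  : last before ≢ just D
    maximalRight : head after ≢ just D

open Descent public

Terminal : ∀ {p} → Descent p → Set
Terminal d = after d ≡ []

ToGround : ∀ {p} → Descent p → Set
ToGround d = height (before d ++ replicate (len d) D) ≡ 0ℤ

Even Odd : ℕ → Set
Even k = 2 ∣ k
Odd  k = 2 ∤ k

InA : ℕ → Path → Set
InA n p =
  IsDyck n p
  × (Σ[ d ∈ Descent p ] (Terminal d × Even (len d)))
  × (∀ (d : Descent p) → ¬ Terminal d → ToGround d → Odd (len d))

-- Membership is proof-irrelevant, so elements of 𝒜 n are equal exactly when
-- their underlying paths are, and 𝒜 n ↔ Fin k says that |𝒜 n| = k.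
𝒜 : ℕ → Set
𝒜 n = [ p ∈ Path ∣ InA n p ]

-- The natural-number division is exact: see catalan-exact.
catalan : ℕ → ℕ
catalan m = ((2 * m) C m) / suc m

private
  absorption : ∀ n k → suc k * (suc n C suc k) ≡ suc n * (n C k)
  absorption zero zero = refl
  absorption zero (suc k) = begin
    suc (suc k) * (1 C suc (suc k))  ≡⟨ cong (suc (suc k) *_) (k>n⇒nCk≡0 (s≤s (s≤s (z≤n {k})))) ⟩
    suc (suc k) * 0                  ≡⟨ *-zeroʳ (suc (suc k)) ⟩
    0                                ≡⟨ cong (1 *_) (k>n⇒nCk≡0 (s≤s (z≤n {k}))) ⟨
    1 * (0 C suc k)                  ∎
    where open ≡-Reasoning
  absorption (suc n) zero = begin
    1 * (suc (suc n) C 1)  ≡⟨ *-identityˡ _ ⟩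
    suc (suc n) C 1        ≡⟨ nC1≡n (suc (suc n)) ⟩
    suc (suc n)            ≡⟨ *-identityʳ _ ⟨
    suc (suc n) * 1        ∎
    where open ≡-Reasoning
  absorption (suc n) (suc j) = begin
    suc k * (suc (suc n) C suc k)
      ≡⟨ cong (suc k *_) (nCk+nC[k+1]≡[n+1]C[k+1] (suc n) k) ⟨
    suc k * (suc n C k + suc n C suc k)
      ≡⟨ rearrange k (suc n C k) (suc n C suc k) ⟩
    suc n C k + (k * (suc n C k) + suc k * (suc n C suc k))
      ≡⟨ cong (suc n C k +_) (cong₂ _+_ (absorption n j) (absorption n k)) ⟩
    suc n C k + (suc n * (n C j) + suc n * (n C k))
      ≡⟨ cong (suc n C k +_) (*-distribˡ-+ (suc n) (n C j) (n C k)) ⟨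
    suc n C k + suc n * (n C j + n C k)
      ≡⟨ cong (λ x → suc n C k + suc n * x) (nCk+nC[k+1]≡[n+1]C[k+1] n j) ⟩
    suc (suc n) * (suc n C k) ∎
    where
    open ≡-Reasoning
    k = suc j
    rearrange : ∀ k a b → suc k * (a + b) ≡ a + (k * a + suc k * b)
    rearrange = solve-∀

  suc∣C : ∀ m → suc m ∣ (2 * m) C m
  suc∣C m = ∣m+n∣m⇒∣n
    (subst (suc m ∣_) (double m ((2 * m) C m)) (m∣m*n (2 * ((2 * m) C m))))
    (subst (suc m ∣_) (absorption (2 * m) m) (m∣m*n (suc (2 * m) C suc m)))
    where
    double : ∀ m c → suc m * (2 * c) ≡ suc (2 * m) * c + c
    double = solve-∀

catalan-exact : ∀ m → suc m * catalan m ≡ (2 * m) C m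
catalan-exact m = m*[n/m]≡n (suc∣C m)

{-# OPTIONS --safe #-}
-- A nonempty Dyck path is uniquely Q U R D with Q and R Dyck.  Every Dyck path
-- factors uniquely as Y Q, where the terminal descent of Y is even (possibly
-- empty) and all descents of Q to ground level are odd.  A path in 𝒜 (n + 1) is
-- Q U (X U Y D) D with exactly these conditions on Y and Q, so it corresponds
-- to the arbitrary nonempty Dyck n-path X U (Y Q) D.  Dyck paths are handled as
-- binary trees, and forests of h trees are counted by ballot numbers.
module Submission where

open import Defs
open import Data.Empty using (⊥)
open import Data.Fin.Base using (Fin)
open import Data.Fin.Properties using (+↔⊎; 0↔⊥; 1↔⊤)
open import Data.Integer.Base as ℤ using (0ℤ; 1ℤ; -1ℤ; +_; +≤+)
import Data.Integer.Properties as ℤ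
open import Data.Irrelevant using ([_]) renaming (map to mapIrrelevant)
open import Data.List.Base using (List; []; _∷_; _++_; replicate; last; length; filter)
open import Data.List.Properties
  using (++-assoc; ++-identityʳ; filter-++; length-++; length-replicate; ∷-injective; ∷-injectiveʳ; ≡-dec)
open import Data.Maybe.Base using (just)
open import Data.Nat.Base using (ℕ; zero; suc; _+_; _*_; _∸_; _≤_; z≤n; s≤s; ≢-nonZero⁻¹)
open import Data.Nat.Combinatorics using (_C_; nCk+nC[k+1]≡[n+1]C[k+1]; nCk≡nC[n∸k]; nC1≡n; k>n⇒nCk≡0)
open import Data.Nat.Divisibility using (_∣_; _∣?_; ∣m+n∣m⇒∣n; ∣1⇒≡1; ∣-refl; ∣m∣n⇒∣m+n; _∣0)
open import Data.Nat.Properties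
  using (suc-injective; +-assoc; +-comm; +-identityʳ; +-suc; m≤m+n; m+n∸m≡n; +-cancelʳ-≡; *-cancelˡ-≡)
open import Data.Nat.Tactic.RingSolver using (solve-∀)
open import Data.Product.Base using (_×_; _,_; proj₁; proj₂; Σ-syntax)
open import Data.Refinement.Base using (Refinement-syntax) renaming (_,_ to _⊣_)
open import Data.Refinement.Properties using (value-injective)
open import Data.Sum.Base using (_⊎_; inj₁; inj₂)
open import Data.Sum.Function.Propositional using (_⊎-↔_)
open import Data.Unit.Base using (⊤; tt)
open import Data.Vec.Base using (Vec; []; _∷_)
open import Function.Bundles using (_↔_; mk↔ₛ′)
open import Function.Construct.Composition using (_↔-∘_)
open import Function.Construct.Symmetry using (↔-sym)
open import Relation.Binary.Definitions using (DecidableEquality)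
open import Relation.Binary.PropositionalEquality
  using (_≡_; _≢_; refl; sym; trans; cong; cong₂; subst; module ≡-Reasoning)
open import Relation.Nullary.Decidable using (yes; no; map′; recompute)
open import Relation.Nullary.Negation using (¬_; contradiction)

-- The round-trip equations depend on membership proofs, which are irrelevant; decidable equality
-- recomputes them into usable ones.
refinement-↔ : ∀ {A B : Set} {P : A → Set} {Q : B → Set} →
  DecidableEquality A → DecidableEquality B → (f : A → B) (g : B → A) →
  (∀ x → P x → Q (f x)) → (∀ y → Q y → P (g y)) →
  (∀ x → P x → g (f x) ≡ x) → (∀ y → Q y → f (g y) ≡ y) →
  [ x ∈ A ∣ P x ] ↔ [ y ∈ B ∣ Q y ]
refinement-↔ _≟A_ _≟B_ f g f-ok g-ok g∘f f∘g = mk↔ₛ′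
  (λ { (x ⊣ [ p ]) → f x ⊣ [ f-ok x p ] })
  (λ { (y ⊣ [ q ]) → g y ⊣ [ g-ok y q ] })
  (λ { (y ⊣ [ q ]) → value-injective (recompute (f (g y) ≟B y) (f∘g y q)) })
  (λ { (x ⊣ [ p ]) → value-injective (recompute (g (f x) ≟A x) (g∘f x p)) })

-- Parity

even⇒odd-suc : ∀ {k} → Even k → Odd (suc k)
even⇒odd-suc {k} e o with ∣1⇒≡1 (∣m+n∣m⇒∣n (subst (2 ∣_) (+-comm 1 k) o) e)
... | ()

-- `Odd` is a bare negation, so evenness of a neighbour can be extracted from it only through this
-- disjunction.
even⊎even-suc : ∀ k → Even k ⊎ Even (suc k)
even⊎even-suc zero = inj₁ (2 ∣0)
even⊎even-suc (suc k) with even⊎even-suc k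
... | inj₁ e = inj₂ (∣m∣n⇒∣m+n ∣-refl e)
... | inj₂ e = inj₁ e

odd-suc⇒even : ∀ {k} → Odd (suc k) → Even k
odd-suc⇒even {k} o with even⊎even-suc k
... | inj₁ e = e
... | inj₂ e = contradiction e o

even-suc⇒odd : ∀ {k} → Even (suc k) → Odd k
even-suc⇒odd e e′ = even⇒odd-suc e′ e

odd⇒even-suc : ∀ {k} → Odd k → Even (suc k)
odd⇒even-suc {k} o with even⊎even-suc k
... | inj₁ e = contradiction e o
... | inj₂ e = e

-- Dyck paths as binary trees

data Tree : Set where
  leaf : Tree
  node : Tree → Tree → Tree

size : Tree → ℕ
size leaf       = 0
size (node Q R) = suc (size Q + size R)

toPath : Tree → Path
toPath leaf       = []
toPath (node Q R) = toPath Q ++ U ∷ toPath R ++ D ∷ []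

infixl 6 _·_
_·_ : Tree → Tree → Tree
Q · leaf     = Q
Q · node S R = node (Q · S) R

leaf-· : ∀ T → leaf · T ≡ T
leaf-· leaf       = refl
leaf-· (node Q R) = cong (λ S → node S R) (leaf-· Q)

size-· : ∀ Q T → size (Q · T) ≡ size Q + size T
size-· Q leaf       = sym (+-identityʳ (size Q))
size-· Q (node S R) = begin
  suc (size (Q · S) + size R)      ≡⟨ cong (λ k → suc (k + size R)) (size-· Q S) ⟩
  suc (size Q + size S + size R)   ≡⟨ cong suc (+-assoc (size Q) _ _) ⟩
  suc (size Q + (size S + size R)) ≡⟨ +-suc (size Q) _ ⟨
  size Q + suc (size S + size R)   ∎
  where open ≡-Reasoning

toPath-· : ∀ Q T → toPath (Q · T) ≡ toPath Q ++ toPath T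
toPath-· Q leaf       = sym (++-identityʳ _)
toPath-· Q (node S R) = trans (cong (_++ _) (toPath-· Q S)) (++-assoc (toPath Q) _ _)

-- After a prefix ending at height h, the parser holds h + 1 trees
-- Q₀, …, Qₕ (Qₕ on top), the prefix read being Q₀ U Q₁ U … U Qₕ.
run : Tree → List Tree → Path → Tree
run T s       []      = T
run T s       (U ∷ p) = run leaf (T ∷ s) p
-- A downstep below ground level: the value is arbitrary. So is the top tree returned when the input
-- ends with a nonempty stack.
run T []      (D ∷ p) = T
run T (Q ∷ s) (D ∷ p) = run (node Q T) s p

parse : Path → Tree
parse = run leaf []

-- Induction on `S` needs `T`, `s` and `r` arbitrary: the subtree `R` is read over a deeper stack,
-- with its closing `D` still to come.
run-toPath : ∀ T s S r → run T s (toPath S ++ r) ≡ run (T · S) s r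
run-toPath T s leaf r = refl
run-toPath T s (node Q R) r = begin
  run T s ((toPath Q ++ U ∷ toPath R ++ D ∷ []) ++ r)
    ≡⟨ cong (run T s) (++-assoc (toPath Q) _ r) ⟩
  run T s (toPath Q ++ U ∷ (toPath R ++ D ∷ []) ++ r)
    ≡⟨ run-toPath T s Q _ ⟩
  run leaf (T · Q ∷ s) ((toPath R ++ D ∷ []) ++ r)
    ≡⟨ cong (run leaf (T · Q ∷ s)) (++-assoc (toPath R) _ r) ⟩
  run leaf (T · Q ∷ s) (toPath R ++ D ∷ r)
    ≡⟨ run-toPath leaf (T · Q ∷ s) R _ ⟩
  run (node (T · Q) (leaf · R)) s r
    ≡⟨ cong (λ S → run (node (T · Q) S) s r) (leaf-· R) ⟩
  run (node (T · Q) R) s r ∎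
  where open ≡-Reasoning

parse-toPath : ∀ T → parse (toPath T) ≡ T
parse-toPath T = begin
  parse (toPath T)       ≡⟨ cong parse (++-identityʳ (toPath T)) ⟨
  parse (toPath T ++ []) ≡⟨ run-toPath leaf [] T [] ⟩
  leaf · T               ≡⟨ leaf-· T ⟩
  T                      ∎
  where open ≡-Reasoning

toPath-injective : ∀ {S T} → toPath S ≡ toPath T → S ≡ T
toPath-injective {S} {T} eq = trans (sym (parse-toPath S)) (trans (cong parse eq) (parse-toPath T))

_≟ᴾ_ : DecidableEquality Path
_≟ᴾ_ = ≡-dec _≟_

_≟ᵀ_ : DecidableEquality Tree
S ≟ᵀ T = map′ toPath-injective (cong toPath) (toPath S ≟ᴾ toPath T)

-- Paths from height h to ground level that stay nonnegative.
data Valid : ℕ → Path → Set where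
  []   : Valid 0 []
  up   : ∀ {h p} → Valid (suc h) p → Valid h (U ∷ p)
  down : ∀ {h p} → Valid h p → Valid (suc h) (D ∷ p)

-- The prefix already read when the parser holds `T` on top of the stack `s`; it serves as the
-- invariant in `toPath-run`.
unparse : Tree → List Tree → Path
unparse T []      = toPath T
unparse T (Q ∷ s) = unparse Q s ++ U ∷ toPath T

unparse-node : ∀ Q T s → unparse (node Q T) s ≡ unparse T (Q ∷ s) ++ D ∷ []
unparse-node Q T []      = sym (++-assoc (toPath Q) _ _)
unparse-node Q T (S ∷ s) = begin
  unparse S s ++ (U ∷ toPath Q) ++ U ∷ toPath T ++ D ∷ []
    ≡⟨ ++-assoc (unparse S s) (U ∷ toPath Q) _ ⟨
  (unparse S s ++ U ∷ toPath Q) ++ U ∷ toPath T ++ D ∷ []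
    ≡⟨ ++-assoc (unparse S s ++ U ∷ toPath Q) (U ∷ toPath T) _ ⟨
  ((unparse S s ++ U ∷ toPath Q) ++ U ∷ toPath T) ++ D ∷ [] ∎
  where open ≡-Reasoning

toPath-run : ∀ {p} T s → Valid (length s) p → toPath (run T s p) ≡ unparse T s ++ p
toPath-run T [] []             = sym (++-identityʳ _)
toPath-run {U ∷ p} T s (up v)  = trans (toPath-run leaf (T ∷ s) v) (++-assoc (unparse T s) _ p)
toPath-run {D ∷ p} T (Q ∷ s) (down v) = begin
  toPath (run (node Q T) s p)          ≡⟨ toPath-run (node Q T) s v ⟩
  unparse (node Q T) s ++ p            ≡⟨ cong (_++ p) (unparse-node Q T s) ⟩
  (unparse T (Q ∷ s) ++ D ∷ []) ++ p   ≡⟨ ++-assoc (unparse T (Q ∷ s)) _ p ⟩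
  unparse T (Q ∷ s) ++ D ∷ p           ∎
  where open ≡-Reasoning

toPath-parse : ∀ {p} → Valid 0 p → toPath (parse p) ≡ p
toPath-parse = toPath-run leaf []

toPath-valid-++ : ∀ {h r} T → Valid h r → Valid h (toPath T ++ r)
toPath-valid-++ leaf v = v
toPath-valid-++ {h} {r} (node Q R) v =
  subst (Valid h) (sym (++-assoc (toPath Q) _ r))
    (toPath-valid-++ Q (up (subst (Valid (suc h)) (sym (++-assoc (toPath R) _ r))
      (toPath-valid-++ R (down v)))))

toPath-valid : ∀ T → Valid 0 (toPath T)
toPath-valid T = subst (Valid 0) (++-identityʳ _) (toPath-valid-++ T [])

-- Heights

height-++ : ∀ p q → height (p ++ q) ≡ height p ℤ.+ height q
height-++ []      q = sym (ℤ.+-identityˡ _)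
height-++ (x ∷ p) q = trans (cong (λ z → rise x ℤ.+ z) (height-++ p q)) (sym (ℤ.+-assoc (rise x) _ _))

up-height : ∀ h x → + h ℤ.+ (1ℤ ℤ.+ x) ≡ + suc h ℤ.+ x
up-height h x = trans (sym (ℤ.+-assoc (+ h) 1ℤ x)) (cong (λ k → + k ℤ.+ x) (+-comm h 1))

down-height : ∀ h x → + suc h ℤ.+ (-1ℤ ℤ.+ x) ≡ + h ℤ.+ x
down-height h x = sym (ℤ.+-assoc (+ suc h) -1ℤ x)

valid-ends : ∀ {h p} → Valid h p → + h ℤ.+ height p ≡ 0ℤ
valid-ends []               = refl
valid-ends (up {h} {p} v)   = trans (up-height h (height p)) (valid-ends v)
valid-ends (down {h} {p} v) = trans (down-height h (height p)) (valid-ends v)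

valid-nonnegative : ∀ {h p} → Valid h p → ∀ q r → q ++ r ≡ p → 0ℤ ℤ.≤ + h ℤ.+ height q
valid-nonnegative v            []      r eq   = +≤+ z≤n
valid-nonnegative (up {h} v)   (U ∷ q) r refl = subst (0ℤ ℤ.≤_) (sym (up-height h (height q))) (valid-nonnegative v q r refl)
valid-nonnegative (down {h} v) (D ∷ q) r refl = subst (0ℤ ℤ.≤_) (sym (down-height h (height q))) (valid-nonnegative v q r refl)

nonnegative⇒valid : ∀ h p → (∀ q r → q ++ r ≡ p → 0ℤ ℤ.≤ + h ℤ.+ height q) →
                    + h ℤ.+ height p ≡ 0ℤ → Valid h p
nonnegative⇒valid zero    []      nn e = []
nonnegative⇒valid (suc h) []      nn ()
nonnegative⇒valid h       (U ∷ p) nn e = up (nonnegative⇒valid (suc h) p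
  (λ q r eq → subst (0ℤ ℤ.≤_) (up-height h (height q)) (nn (U ∷ q) r (cong (U ∷_) eq)))
  (trans (sym (up-height h (height p))) e))
nonnegative⇒valid zero    (D ∷ p) nn e with nn (D ∷ []) p refl
... | ()
nonnegative⇒valid (suc h) (D ∷ p) nn e = down (nonnegative⇒valid h p
  (λ q r eq → subst (0ℤ ℤ.≤_) (down-height h (height q)) (nn (D ∷ q) r (cong (D ∷_) eq)))
  (trans (sym (down-height h (height p))) e))

-- Cuts a path at a visit to ground level, so that a descent to ground level yields a factorization
-- into Dyck paths.
valid-split : ∀ {h} w {r} → Valid h (w ++ r) → + h ℤ.+ height w ≡ 0ℤ → Valid h w × Valid 0 r
valid-split {zero}  []      v          e = [] , v
valid-split {suc h} []      v          ()
valid-split {h}     (U ∷ w) (up v)     e with valid-split w v (trans (sym (up-height h (height w))) e)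
... | vw , vr = up vw , vr
valid-split {suc h} (D ∷ w) (down v)   e with valid-split w v (trans (sym (down-height h (height w))) e)
... | vw , vr = down vw , vr

height-toPath : ∀ T → height (toPath T) ≡ 0ℤ
height-toPath T = trans (sym (ℤ.+-identityˡ _)) (valid-ends (toPath-valid T))

-- Step counts and the Dyck property

count-++ : ∀ s p q → count s (p ++ q) ≡ count s p + count s q
count-++ s p q = trans (cong length (filter-++ (s ≟_) p q)) (length-++ (filter (s ≟_) p))

count-toPath : ∀ s T → count s (toPath T) ≡ size T
count-toPath s leaf = refl
count-toPath s (node Q R) = begin
  count s (toPath Q ++ U ∷ toPath R ++ D ∷ [])
    ≡⟨ count-++ s (toPath Q) _ ⟩
  count s (toPath Q) + count s (U ∷ toPath R ++ D ∷ [])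
    ≡⟨ cong₂ _+_ (count-toPath s Q) (inner s) ⟩
  size Q + suc (size R)
    ≡⟨ +-suc (size Q) (size R) ⟩
  suc (size Q + size R) ∎
  where
  open ≡-Reasoning
  inner : ∀ s → count s (U ∷ toPath R ++ D ∷ []) ≡ suc (size R)
  inner U = cong suc (trans (count-++ U (toPath R) _) (trans (+-identityʳ _) (count-toPath U R)))
  inner D = trans (count-++ D (toPath R) _) (trans (+-comm _ 1) (cong suc (count-toPath D R)))

dyck⇒valid : ∀ {n p} → IsDyck n p → Valid 0 p
dyck⇒valid {p = p} dyck = nonnegative⇒valid 0 p
  (λ q r eq → subst (0ℤ ℤ.≤_) (sym (ℤ.+-identityˡ _)) (IsDyck.nonnegative dyck q r eq))
  (trans (ℤ.+-identityˡ _) (IsDyck.ends dyck))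

toPath-dyck : ∀ T → IsDyck (size T) (toPath T)
toPath-dyck T = record
  { upsteps     = count-toPath U T
  ; downsteps   = count-toPath D T
  ; ends        = height-toPath T
  ; nonnegative = λ q r eq → subst (0ℤ ℤ.≤_) (ℤ.+-identityˡ _) (valid-nonnegative (toPath-valid T) q r eq)
  }

-- Terminal descents

-- The terminal descent of `Q U R D` is that of `R` followed by the last `D`, so its length is that
-- of the right spine.
tail : Tree → ℕ
tail leaf       = 0
tail (node Q R) = suc (tail R)

stem : Tree → Path
stem leaf       = []
stem (node Q R) = toPath Q ++ U ∷ stem R

replicate-∷ʳ : ∀ k (x : Step) → replicate k x ++ x ∷ [] ≡ replicate (suc k) x
replicate-∷ʳ zero    x = refl
replicate-∷ʳ (suc k) x = cong (x ∷_) (replicate-∷ʳ k x)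

stem-tail : ∀ T → stem T ++ replicate (tail T) D ≡ toPath T
stem-tail leaf       = refl
stem-tail (node Q R) = begin
  (toPath Q ++ U ∷ stem R) ++ replicate (suc k) D
    ≡⟨ ++-assoc (toPath Q) _ _ ⟩
  toPath Q ++ U ∷ stem R ++ replicate (suc k) D
    ≡⟨ cong (λ p → toPath Q ++ U ∷ stem R ++ p) (replicate-∷ʳ k D) ⟨
  toPath Q ++ U ∷ stem R ++ replicate k D ++ D ∷ []
    ≡⟨ cong (λ p → toPath Q ++ U ∷ p) (++-assoc (stem R) _ _) ⟨
  toPath Q ++ U ∷ (stem R ++ replicate k D) ++ D ∷ []
    ≡⟨ cong (λ p → toPath Q ++ U ∷ p ++ D ∷ []) (stem-tail R) ⟩
  toPath Q ++ U ∷ toPath R ++ D ∷ [] ∎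
  where
  open ≡-Reasoning
  k = tail R

last-++-U : ∀ p {s} → last s ≢ just D → last (p ++ U ∷ s) ≢ just D
last-++-U []          {[]}    l ()
last-++-U []          {_ ∷ _} l = l
last-++-U (_ ∷ [])    {s}     l = last-++-U [] {s} l
last-++-U (_ ∷ x ∷ p)         l = last-++-U (x ∷ p) l

last-stem : ∀ T → last (stem T) ≢ just D
last-stem leaf       ()
last-stem (node Q R) = last-++-U (toPath Q) (last-stem R)

last-replicate : ∀ k x p {r} → replicate k D ≡ x ∷ p ++ r → last (x ∷ p) ≡ just D
last-replicate (suc k) x []      eq = cong just (sym (proj₁ (∷-injective eq)))
last-replicate (suc k) x (y ∷ p) eq = last-replicate k y p (∷-injectiveʳ eq)

last-∷ : ∀ x p → last (x ∷ p) ≢ just D → last p ≢ just D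
last-∷ x []      l ()
last-∷ x (_ ∷ _) l = l

-- If one prefix is exhausted first, the rest of the other is a nonempty initial part of a run of
-- downsteps and ends in `D`, against its hypothesis.
terminal-run-unique : ∀ p k q l → last p ≢ just D → last q ≢ just D →
  p ++ replicate k D ≡ q ++ replicate l D → k ≡ l
terminal-run-unique [] k [] l _ _ eq =
  trans (sym (length-replicate k)) (trans (cong length eq) (length-replicate l))
terminal-run-unique []      k (y ∷ q) l _  lq eq = contradiction (last-replicate k y q eq) lq
terminal-run-unique (x ∷ p) k []      l lp _  eq = contradiction (last-replicate l x p (sym eq)) lp
terminal-run-unique (x ∷ p) k (y ∷ q) l lp lq eq =
  terminal-run-unique p k q l (last-∷ x p lp) (last-∷ y q lq) (∷-injectiveʳ eq)

tail-unique : ∀ T p k → last p ≢ just D → p ++ replicate k D ≡ toPath T → k ≡ tail T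
tail-unique T p k l eq =
  terminal-run-unique p k (stem T) (tail T) l (last-stem T) (trans eq (sym (stem-tail T)))

-- The image of 𝒜 among trees

-- One condition for each prime factor `U R D` on the left spine, whose final descent has length
-- `suc (tail R)`. The terminal descent is included, because in `IsA` an upstep follows `Q`.
OddReturns : Tree → Set
OddReturns leaf       = ⊤
OddReturns (node Q R) = OddReturns Q × Odd (suc (tail R))

IsA : Tree → Set
IsA leaf       = ⊥
IsA (node Q R) = OddReturns Q × Even (suc (tail R))

OddInnerDescents : Path → Set
OddInnerDescents p = ∀ (d : Descent p) → ¬ Terminal d → ToGround d → Odd (len d)

-- The upstep after `Q` makes each of its returns end a non-terminal descent. The remainder `r` is
-- arbitrary because it grows by a prime factor at each recursive call.
oddInnerDescents⇒oddReturns : ∀ Q r → OddInnerDescents (toPath Q ++ U ∷ r) → OddReturns Q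
oddInnerDescents⇒oddReturns leaf       r odd = tt
oddInnerDescents⇒oddReturns T@(node Q R) r odd =
  oddInnerDescents⇒oddReturns Q _ (subst OddInnerDescents (++-assoc (toPath Q) _ _) odd) ,
  odd descent (λ ()) (trans (cong height (stem-tail T)) (height-toPath T))
  where
  descent : Descent (toPath T ++ U ∷ r)
  descent = record
    { before       = stem T
    ; len          = tail T
    ; after        = U ∷ r
    ; split        = trans (sym (++-assoc (stem T) _ _)) (cong (_++ U ∷ r) (stem-tail T))
    ; nonempty     = _
    ; maximalLeft  = last-stem T
    ; maximalRight = λ ()
    }

inA⇒isA : ∀ {n} T → InA n (toPath T) → IsA T × size T ≡ n
inA⇒isA T (dyck , (d , terminal , even) , odd) =
  isA T len≡tail odd , trans (sym (count-toPath U T)) (IsDyck.upsteps dyck)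
  where
  len≡tail : len d ≡ tail T
  len≡tail = tail-unique T (before d) (len d) (maximalLeft d) (begin
    before d ++ replicate (len d) D             ≡⟨ cong (before d ++_) (++-identityʳ _) ⟨
    before d ++ replicate (len d) D ++ []       ≡⟨ cong (λ p → before d ++ replicate (len d) D ++ p) terminal ⟨
    before d ++ replicate (len d) D ++ after d  ≡⟨ split d ⟩
    toPath T                                    ∎)
    where open ≡-Reasoning
  isA : ∀ T → len d ≡ tail T → OddInnerDescents (toPath T) → IsA T
  isA leaf       eq odd = contradiction eq (≢-nonZero⁻¹ (len d) {{nonempty d}})
  isA (node Q R) eq odd = oddInnerDescents⇒oddReturns Q _ odd , subst Even eq even

oddReturns-·ˡ : ∀ S A → OddReturns (S · A) → OddReturns S
oddReturns-·ˡ S leaf       o       = o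
oddReturns-·ˡ S (node A B) (o , _) = oddReturns-·ˡ S A o

-- A descent to ground level ends a Dyck prefix `w`, which splits `T` as `S · S′`. Its length is
-- `tail S`, and `S′` is nonempty because the descent is not terminal.
isA⇒oddInnerDescents : ∀ T → IsA T → OddInnerDescents (toPath T)
isA⇒oddInnerDescents T isA d inner ground =
  conclude S S′ len≡tail (λ eq → inner (trans (sym S′-path) (cong toPath eq))) (subst IsA (sym S·S′≡T) isA)
  where
  open ≡-Reasoning
  w = before d ++ replicate (len d) D
  w-split : w ++ after d ≡ toPath T
  w-split = trans (++-assoc (before d) _ _) (split d)
  valid : Valid 0 w × Valid 0 (after d)
  valid = valid-split w (subst (Valid 0) (sym w-split) (toPath-valid T)) (trans (ℤ.+-identityˡ _) ground)
  S S′ : Tree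
  S  = parse w
  S′ = parse (after d)
  S-path : toPath S ≡ w
  S-path = toPath-parse (proj₁ valid)
  S′-path : toPath S′ ≡ after d
  S′-path = toPath-parse (proj₂ valid)
  len≡tail : len d ≡ tail S
  len≡tail = tail-unique S (before d) (len d) (maximalLeft d) (sym S-path)
  S·S′≡T : S · S′ ≡ T
  S·S′≡T = toPath-injective (begin
    toPath (S · S′)        ≡⟨ toPath-· S S′ ⟩
    toPath S ++ toPath S′  ≡⟨ cong₂ _++_ S-path S′-path ⟩
    w ++ after d           ≡⟨ w-split ⟩
    toPath T               ∎)
  conclude : ∀ S S′ → len d ≡ tail S → S′ ≢ leaf → IsA (S · S′) → Odd (len d)
  conclude leaf         _          eq _  _       = contradiction eq (≢-nonZero⁻¹ (len d) {{nonempty d}})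
  conclude (node _ _)   leaf       eq ne _       = contradiction refl ne
  -- Here `S · S′` is `node (S · A) B`, so `S` is an initial factor of the part with odd returns.
  conclude S@(node _ _) (node A B) eq _  (o , _) = subst Odd (sym eq) (proj₂ (oddReturns-·ˡ S A o))

isA⇒terminalEven : ∀ T → IsA T → Σ[ d ∈ Descent (toPath T) ] (Terminal d × Even (len d))
isA⇒terminalEven T@(node Q R) (_ , even) = record
  { before       = stem T
  ; len          = tail T
  ; after        = []
  ; split        = trans (cong (stem T ++_) (++-identityʳ _)) (stem-tail T)
  ; nonempty     = _
  ; maximalLeft  = last-stem T
  ; maximalRight = λ ()
  } , refl , even

isA⇒inA : ∀ {n} T → IsA T × size T ≡ n → InA n (toPath T)
isA⇒inA T (isA , refl) = toPath-dyck T , isA⇒terminalEven T isA , isA⇒oddInnerDescents T isA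

𝒜↔trees : ∀ n → 𝒜 n ↔ [ T ∈ Tree ∣ IsA T × size T ≡ n ]
𝒜↔trees n = refinement-↔ _≟ᴾ_ _≟ᵀ_ parse toPath
  (λ p inA → inA⇒isA (parse p) (subst (InA n) (sym (toPath-parse (dyck⇒valid (proj₁ inA)))) inA))
  isA⇒inA
  (λ p inA → toPath-parse (dyck⇒valid (proj₁ inA)))
  (λ T _ → parse-toPath T)

-- The factorization into an even-tailed tree and a tree with odd returns

-- Prime factors move from the right end into the second component until the last one remaining ends
-- in an even descent, or none remains.
factor : Tree → Tree × Tree
factor leaf = leaf , leaf
factor (node Z R) with 2 ∣? suc (tail R)
... | yes _ = node Z R , leaf
... | no  _ = proj₁ (factor Z) , node (proj₂ (factor Z)) R

factor-· : ∀ Z → proj₁ (factor Z) · proj₂ (factor Z) ≡ Z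
factor-· leaf = refl
factor-· (node Z R) with 2 ∣? suc (tail R)
... | yes _ = refl
... | no  _ = cong (λ S → node S R) (factor-· Z)

factor-even : ∀ Z → Even (tail (proj₁ (factor Z)))
factor-even leaf = 2 ∣0
factor-even (node Z R) with 2 ∣? suc (tail R)
... | yes e = e
... | no  _ = factor-even Z

factor-odd : ∀ Z → OddReturns (proj₂ (factor Z))
factor-odd leaf = tt
factor-odd (node Z R) with 2 ∣? suc (tail R)
... | yes _ = tt
... | no  o = factor-odd Z , o

-- The odd returns of `Q` keep the scan from stopping inside `Q`; the even tail of `Y` makes it stop
-- as soon as `Y` is reached.
factor-unique : ∀ Y Q → Even (tail Y) → OddReturns Q → factor (Y · Q) ≡ (Y , Q)
factor-unique leaf leaf e _ = refl
factor-unique (node Z R) leaf e _ with 2 ∣? suc (tail R)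
... | yes _ = refl
... | no  o = contradiction e o
factor-unique Y (node Q R) e (os , o) with 2 ∣? suc (tail R)
... | yes e′ = contradiction e′ o
... | no  _  = cong (λ YQ → proj₁ YQ , node (proj₂ YQ) R) (factor-unique Y Q e os)

-- Trees in the image of 𝒜 and all nonempty trees

squash : Tree → Tree
squash (node Q (node X Y)) = node X (Y · Q)
-- A default for `leaf` and `node Q leaf`, neither of which satisfies `IsA`: the first has no
-- terminal descent, the second one of length 1.
squash _                   = leaf

unsquash : Tree → Tree
unsquash leaf       = leaf
unsquash (node X Z) = node (proj₂ (factor Z)) (node X (proj₁ (factor Z)))

isA-leaf : ∀ {Q} → ¬ IsA (node Q leaf)
isA-leaf (_ , e) with ∣1⇒≡1 e
... | ()

isA-trees↔trees : ∀ m → [ T ∈ Tree ∣ IsA T × size T ≡ suc (suc m) ] ↔ [ Z ∈ Tree ∣ size Z ≡ suc m ]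
isA-trees↔trees m = refinement-↔ _≟ᵀ_ _≟ᵀ_ squash unsquash squash-size unsquash-isA unsquash-squash squash-unsquash
  where
  size-rearrange : ∀ q x y → suc (q + suc (x + y)) ≡ suc (suc (x + (y + q)))
  size-rearrange = solve-∀

  squash-size : ∀ T → IsA T × size T ≡ suc (suc m) → size (squash T) ≡ suc m
  squash-size (node Q leaf)       (isA , _)  = contradiction isA (isA-leaf {Q})
  squash-size (node Q (node X Y)) (_   , eq) = suc-injective (begin
    suc (suc (size X + size (Y · Q)))      ≡⟨ cong (λ k → suc (suc (size X + k))) (size-· Y Q) ⟩
    suc (suc (size X + (size Y + size Q))) ≡⟨ size-rearrange (size Q) (size X) (size Y) ⟨
    suc (size Q + suc (size X + size Y))   ≡⟨ eq ⟩
    suc (suc m)                            ∎)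
    where open ≡-Reasoning

  unsquash-isA : ∀ Z → size Z ≡ suc m → IsA (unsquash Z) × size (unsquash Z) ≡ suc (suc m)
  unsquash-isA (node X Z) eq =
    -- The terminal descent is that of `Y` lengthened by two downsteps, hence still even.
    (factor-odd Z , ∣m∣n⇒∣m+n ∣-refl (factor-even Z)) , (begin
      suc (size Q + suc (size X + size Y))   ≡⟨ size-rearrange (size Q) (size X) (size Y) ⟩
      suc (suc (size X + (size Y + size Q))) ≡⟨ cong (λ k → suc (suc (size X + k))) (size-· Y Q) ⟨
      suc (suc (size X + size (Y · Q)))      ≡⟨ cong (λ S → suc (suc (size X + size S))) (factor-· Z) ⟩
      suc (suc (size X + size Z))            ≡⟨ cong suc eq ⟩
      suc (suc m)                            ∎)
    where
    open ≡-Reasoning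
    Y = proj₁ (factor Z)
    Q = proj₂ (factor Z)

  unsquash-squash : ∀ T → IsA T × size T ≡ suc (suc m) → unsquash (squash T) ≡ T
  unsquash-squash (node Q leaf)       (isA , _)      = contradiction isA (isA-leaf {Q})
  unsquash-squash (node Q (node X Y)) ((o , e) , _) =
    cong (λ YQ → node (proj₂ YQ) (node X (proj₁ YQ))) (factor-unique Y Q (odd-suc⇒even (even-suc⇒odd e)) o)

  squash-unsquash : ∀ Z → size Z ≡ suc m → squash (unsquash Z) ≡ Z
  squash-unsquash (node X Z) _ = cong (node X) (factor-· Z)

-- Counting forests

sizes : ∀ {h} → Vec Tree h → ℕ
sizes []      = 0
sizes (T ∷ v) = size T + sizes v

Forest : ℕ → ℕ → Set
Forest h n = [ v ∈ Vec Tree h ∣ sizes v ≡ n ]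

-- The coefficient of `x^n` in the `h`-th power of the Catalan generating function `c`; the last
-- clause is `c^(h+1) = c^h + x c^(h+2)`.
ballot : ℕ → ℕ → ℕ
ballot zero    zero    = 1
ballot zero    (suc n) = 0
ballot (suc h) zero    = ballot h zero
ballot (suc h) (suc n) = ballot h (suc n) + ballot (suc (suc h)) n

forest-zero↔ : ∀ h → Forest (suc h) 0 ↔ Forest h 0
forest-zero↔ h = mk↔ₛ′
  (λ { ((leaf ∷ v) ⊣ e) → v ⊣ e ; ((node _ _ ∷ _) ⊣ [ () ]) })
  (λ { (v ⊣ e) → (leaf ∷ v) ⊣ e })
  (λ _ → refl)
  (λ { ((leaf ∷ v) ⊣ e) → refl ; ((node _ _ ∷ _) ⊣ [ () ]) })

-- The first tree is either empty and dropped, or replaced by its two subtrees.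
forest-suc↔ : ∀ h n → Forest (suc h) (suc n) ↔ (Forest h (suc n) ⊎ Forest (suc (suc h)) n)
forest-suc↔ h n = mk↔ₛ′
  (λ { ((leaf ∷ v) ⊣ e) → inj₁ (v ⊣ e)
     ; ((node Q R ∷ v) ⊣ e) → inj₂ ((Q ∷ R ∷ v) ⊣ mapIrrelevant (λ eq → trans (sym (+-assoc (size Q) _ _)) (suc-injective eq)) e) })
  (λ { (inj₁ (v ⊣ e)) → (leaf ∷ v) ⊣ e
     ; (inj₂ ((Q ∷ R ∷ v) ⊣ e)) → (node Q R ∷ v) ⊣ mapIrrelevant (λ eq → cong suc (trans (+-assoc (size Q) _ _) eq)) e })
  (λ { (inj₁ _) → refl ; (inj₂ ((_ ∷ _ ∷ _) ⊣ _)) → refl })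
  (λ { ((leaf ∷ _) ⊣ _) → refl ; ((node _ _ ∷ _) ⊣ _) → refl })

forest↔ballot : ∀ h n → Forest h n ↔ Fin (ballot h n)
forest↔ballot zero zero = ↔-sym 1↔⊤ ↔-∘ mk↔ₛ′ (λ _ → tt) (λ _ → [] ⊣ [ refl ]) (λ _ → refl) (λ { ([] ⊣ _) → refl })
forest↔ballot zero (suc n) = ↔-sym 0↔⊥ ↔-∘ mk↔ₛ′
  (λ { ([] ⊣ [ () ]) }) (λ ()) (λ ()) (λ { ([] ⊣ [ () ]) })
forest↔ballot (suc h) zero = forest↔ballot h zero ↔-∘ forest-zero↔ h
forest↔ballot (suc h) (suc n) =
  ↔-sym +↔⊎ ↔-∘ ((forest↔ballot h (suc n) ⊎-↔ forest↔ballot (suc (suc h)) n) ↔-∘ forest-suc↔ h n)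

trees↔forest : ∀ n → [ T ∈ Tree ∣ size T ≡ n ] ↔ Forest 1 n
trees↔forest n = mk↔ₛ′
  (λ { (T ⊣ e) → (T ∷ []) ⊣ mapIrrelevant (trans (+-identityʳ _)) e })
  (λ { ((T ∷ []) ⊣ e) → T ⊣ mapIrrelevant (trans (sym (+-identityʳ _))) e })
  (λ { ((_ ∷ []) ⊣ _) → refl })
  (λ { (_ ⊣ _) → refl })

-- Closed form of the ballot numbers

-- The two middle entries of an odd row agree. This is the boundary case `h = 0` of the reflection
-- formula, where the ballot number vanishes.
central-symmetry : ∀ n → suc (2 * n) C n ≡ suc (2 * n) C suc n
central-symmetry n = begin
  suc (2 * n) C n                  ≡⟨ cong (_C n) (2n+1 n) ⟩
  (n + suc n) C n                  ≡⟨ nCk≡nC[n∸k] (m≤m+n n (suc n)) ⟩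
  (n + suc n) C (n + suc n ∸ n)    ≡⟨ cong ((n + suc n) C_) (m+n∸m≡n n (suc n)) ⟩
  (n + suc n) C suc n              ≡⟨ cong (_C suc n) (2n+1 n) ⟨
  suc (2 * n) C suc n              ∎
  where
  open ≡-Reasoning
  2n+1 : ∀ n → suc (2 * n) ≡ n + suc n
  2n+1 = solve-∀

ballot-zero : ∀ h → ballot h 0 ≡ 1
ballot-zero zero    = refl
ballot-zero (suc h) = ballot-zero h

-- The reflection formula, with the subtracted binomial moved to the left.
ballot-reflection : ∀ h n → ballot h (suc n) + suc (2 * n + h) C n ≡ suc (2 * n + h) C suc n
ballot-reflection zero n =
  subst (λ k → suc k C n ≡ suc k C suc n) (sym (+-identityʳ (2 * n))) (central-symmetry n)
ballot-reflection (suc h) zero = begin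
  ballot h 1 + ballot (suc (suc h)) 0 + 1  ≡⟨ cong (λ k → ballot h 1 + k + 1) (ballot-zero h) ⟩
  ballot h 1 + 1 + 1                       ≡⟨ cong (_+ 1) (ballot-reflection h 0) ⟩
  suc h C 1 + 1                            ≡⟨ cong (_+ 1) (nC1≡n (suc h)) ⟩
  suc h + 1                                ≡⟨ +-comm (suc h) 1 ⟩
  suc (suc h)                              ≡⟨ nC1≡n (suc (suc h)) ⟨
  suc (suc h) C 1                          ∎
  where open ≡-Reasoning
ballot-reflection (suc h) n@(suc k) = begin
  ballot h (suc n) + ballot (suc (suc h)) n + suc (2 * n + suc h) C n
    ≡⟨ cong (λ i → ballot h (suc n) + ballot (suc (suc h)) n + suc i C n) (+-suc (2 * n) h) ⟩
  ballot h (suc n) + ballot (suc (suc h)) n + suc M C n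
    ≡⟨ cong (λ i → ballot h (suc n) + ballot (suc (suc h)) n + i) (nCk+nC[k+1]≡[n+1]C[k+1] M k) ⟨
  ballot h (suc n) + ballot (suc (suc h)) n + (M C k + M C n)
    ≡⟨ rearrange (ballot h (suc n)) _ _ _ ⟩
  (ballot (suc (suc h)) n + M C k) + (ballot h (suc n) + M C n)
    -- Both induction hypotheses, at `(h + 2, k)` and at `(h, n)`, live in row `M`, since
    -- `2 * k + (h + 2) = 2 * n + h`.
    ≡⟨ cong₂ _+_ (subst (λ i → ballot (suc (suc h)) n + suc i C k ≡ suc i C n) (index k h) (ballot-reflection (suc (suc h)) k))
                 (ballot-reflection h n) ⟩
  M C n + M C suc n
    ≡⟨ nCk+nC[k+1]≡[n+1]C[k+1] M n ⟩
  suc M C suc n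
    ≡⟨ cong (λ i → suc i C suc n) (+-suc (2 * n) h) ⟨
  suc (2 * n + suc h) C suc n ∎
  where
  open ≡-Reasoning
  M = suc (2 * n + h)
  index : ∀ k h → 2 * k + suc (suc h) ≡ 2 * suc k + h
  index = solve-∀
  rearrange : ∀ a b c d → a + b + (c + d) ≡ (b + c) + (a + d)
  rearrange = solve-∀

-- Neighbouring binomials have ratio `(n - k) / (k + 1)`; keeping `k * (n C k)` on the left avoids
-- truncated subtraction. The induction is by Pascal's rule.
C-ratio : ∀ n k → suc k * (n C suc k) + k * (n C k) ≡ n * (n C k)
C-ratio zero    zero    = refl
C-ratio zero    (suc k)
  rewrite k>n⇒nCk≡0 {0} {suc k} (s≤s z≤n) | k>n⇒nCk≡0 {0} {suc (suc k)} (s≤s z≤n) = zeros (suc (suc k)) (suc k)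
  where
  zeros : ∀ a b → a * 0 + b * 0 ≡ 0
  zeros = solve-∀
C-ratio (suc n) zero    = trans (cong (λ i → 1 * i + 0) (nC1≡n (suc n))) (one (suc n))
  where
  one : ∀ n → 1 * n + 0 ≡ n * 1
  one = solve-∀
C-ratio (suc n) (suc j) = begin
  suc k * (suc n C suc k) + k * (suc n C k)
    ≡⟨ cong₂ (λ a b → suc k * a + k * b) (nCk+nC[k+1]≡[n+1]C[k+1] n k) (nCk+nC[k+1]≡[n+1]C[k+1] n j) ⟨
  suc k * (b + c) + k * (a + b)
    -- One copy of `a + b` is split off, so that the other terms are the left sides of the induction
    -- hypotheses at `k` and `j`.
    ≡⟨ rearrange j a b c ⟩
  (suc k * c + k * b) + (suc j * b + j * a) + (a + b)
    ≡⟨ cong₂ (λ x y → x + y + (a + b)) (C-ratio n k) (C-ratio n j) ⟩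
  n * b + n * a + (a + b)
    ≡⟨ collect n a b ⟩
  suc n * (a + b)
    ≡⟨ cong (suc n *_) (nCk+nC[k+1]≡[n+1]C[k+1] n j) ⟩
  suc n * (suc n C k) ∎
  where
  open ≡-Reasoning
  k = suc j
  a = n C j
  b = n C k
  c = n C suc k
  rearrange : ∀ j a b c → suc (suc j) * (b + c) + suc j * (a + b)
            ≡ (suc (suc j) * c + suc j * b) + (suc j * b + j * a) + (a + b)
  rearrange = solve-∀
  collect : ∀ n a b → n * b + n * a + (a + b) ≡ suc n * (a + b)
  collect = solve-∀

-- Reflection gives `b = c - c′` and the ratio gives `c′ = m / (m + 1) * c`, so `(m + 1) * b = c`,
-- the equation that characterizes the Catalan number.
ballot≡catalan : ∀ k → ballot 1 (suc k) ≡ catalan (suc k)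
ballot≡catalan k = *-cancelˡ-≡ _ _ (suc m) (trans closed (sym (catalan-exact m)))
  where
  open ≡-Reasoning
  m = suc k
  b = ballot 1 m
  c = (2 * m) C m
  c′ = (2 * m) C k
  reflection : b + c′ ≡ c
  reflection = subst (λ i → b + i C k ≡ i C m) (index k) (ballot-reflection 1 k)
    where
    index : ∀ k → suc (2 * k + 1) ≡ 2 * suc k
    index = solve-∀
  ratio : m * c ≡ suc m * c′
  -- Since `2 * m = suc m + k`, cancelling `k * c′` leaves the factor `suc m`.
  ratio = +-cancelʳ-≡ (k * c′) _ _ (trans (C-ratio (2 * m) k) (two k c′))
    where
    two : ∀ k x → 2 * suc k * x ≡ suc (suc k) * x + k * x
    two = solve-∀
  closed : suc m * b ≡ c
  closed = +-cancelʳ-≡ (m * c) _ _ (begin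
    suc m * b + m * c       ≡⟨ cong (λ x → suc m * b + x) ratio ⟩
    suc m * b + suc m * c′  ≡⟨ distrib (suc m) b c′ ⟩
    suc m * (b + c′)        ≡⟨ cong (suc m *_) reflection ⟩
    c + m * c               ∎)
    where
    distrib : ∀ a x y → a * x + a * y ≡ a * (x + y)
    distrib = solve-∀

theorem1 : ∀ (n : ℕ) → 2 ≤ n → 𝒜 n ↔ Fin (catalan (n ∸ 1))
theorem1 (suc zero) (s≤s ())
theorem1 (suc (suc m)) _ =
  subst (λ k → 𝒜 (suc (suc m)) ↔ Fin k) (ballot≡catalan m)
    ((forest↔ballot 1 (suc m) ↔-∘ trees↔forest (suc m)) ↔-∘ (isA-trees↔trees m ↔-∘ 𝒜↔trees (suc (suc m))))
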